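{- Let $(\mathbf{RB},f^k)\in\mathsf{MRBA^k}$, let $h:\mathcal{L}(\mathbb{P})\to\mathbf{RB}$ be a homomorphism and $h^+:\mathcal{L}^{A,K}(\mathbb{P})\to\mathbf{RB}$ its extension. Let $M=(F^{\mathbf{RB}},\geq^{\mathbf{RB}},\mathrm{R}^{\mathbf{RB}},L^h,V^h)$ where $L^h(p)=\{u\in F^{\mathbf{RB}}\mid 1_{h(p)}\in u\}$ and $V^h(p)=\{u\in F^{\mathbf{RB}}\mid h(p)\in u\}$ for $p\in\mathbb{P}$. Then for all $\phi\in\mathcal{L}^{A,K}(\mathbb{P})$, $$L^h(\phi)=\{u\in F^{\mathbf{RB}}\mid 1_{h^+(\phi)}\in u\}\quad\text{and}\quad V^h(\phi)=\{u\in F^{\mathbf{RB}}\mid h^+(\phi)\in u\}.$$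
   Context: Languages. $\mathbb{P}$ is a set of propositional variables. $\mathcal{L}(\mathbb{P})$ has grammar $\phi::=p\mid 1\mid\neg\phi\mid(\phi\land\phi)$, $p\in\mathbb{P}$, with $0\equiv\neg1$, $\phi\lor\psi\equiv\neg(\neg\phi\land\neg\psi)$. $\mathcal{L}^{A,K}(\mathbb{P})$ has grammar $\phi::=p\mid 1\mid\neg\phi\mid(\phi\land\phi)\mid A\phi\mid K\phi$. $\mathcal{L}(\mathbb{P})$ is also regarded as an algebra with operations given by the connectives. Relativized Boolean algebras. An algebra of Boolean similarity type is $\langle RB,\land,\lor,\neg,0,1\rangle$ with $0,1\in RB$, $\land,\lor$ binary and $\neg$ unary. A homomorphism is a map with $h(1)=1'$ respecting $\land,\lor,\neg$ (preservation of $0$ not required). Write $1_X:=X\lor\neg X$, $0_X:=X\land\neg X$, and $Y\geq X$ iff $X\land Y=X$. A relativized Boolean algebra is such an algebra satisfying: (RB1) $\land,\lor$ are associative, commutative, distributive (each over the other), and with $\neg$ satisfy De Morgan's laws; (RB2) $X\land X=X\lor X=X\land 1=\neg\neg X=X$; (RB3) $X\lor 1=1_X$; (RB4) $X\land 0=0$; (RB5) $X\geq Y$ implies $\neg(X\land 1_Y)=\neg X\land 1_Y$. $\mathsf{MRBA^k}$ is the class of pairs $(\mathbf{RB},f^k)$ with $\mathbf{RB}$ a relativized Boolean algebra and $f^k:RB\to RB$ satisfying: (f1) $f^k(1)=1$; (f2) $f^k(X\land Y)=f^k(X)\land f^k(Y)$; (fD) $f^k(0_X)=0_X$; (fk) $1_{f^k(X)}=1_X$.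 Define $f^A(X)=f^k(1_X)$. The extension $h^+$ of $h$ respects $1,\neg,\land$ and satisfies $h^+(A\phi)=f^A(h^+(\phi))$, $h^+(K\phi)=f^k(h^+(\phi))$. Filters. Let $\pi_2(\mathbf{RB})=\{1_X\mid X\in RB\}$ and $\pi_1(X)=\{Z\in RB\mid 1_Z=1_X\}$; each $\pi_1(X)$ is a Boolean algebra with top $1_X$, bottom $0_X$ and inherited operations. A filter is a subset containing the top element, upward closed under $\geq$, and closed under $\land$. It is strongly proper if it contains no element of the form $X\land\neg X$. An ultrafilter is a strongly proper filter not properly contained in any strongly proper filter. $\mathscr{F}(\cdot)$ and $\mathscr{U}(\cdot)$ denote the sets of filters and ultrafilters. For a filter $u$ of $\mathbf{RB}$, $\pi_2(u)=u\cap\pi_2(\mathbf{RB})$, $\pi_1(u,X)=u\cap\pi_1(X)$, and $$F^{\mathbf{RB}}=\{u\in\mathscr{F}(\mathbf{RB})\mid\pi_1(u,X)\in\mathscr{U}(\pi_1(X))\text{ for all }X\in\pi_2(u)\}.$$ On $F^{\mathbf{RB}}$: $u\geq^{\mathbf{RB}}v$ iff $\pi_2(u)\supseteq\pi_2(v)$; $u\,\mathrm{R}^{\mathbf{RB}}v$ iff for all $X\in RB$, $f^k(X)\in u$ implies $X\in v$. Awareness models. An ordered frame is a pre-ordered set $(W,\geq)$ with a serial binary relation $\mathrm{R}$; $\mathrm{R}(\omega)=\{\omega'\mid\omega\mathrm{R}\omega'\}$. An awareness model is $M=(W,\geq,\mathrm{R},L,V)$ with $(W,\geq,\mathrm{R})$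 an ordered frame and $L,V:\mathbb{P}\to\mathscr{P}(W)$, $L(p)$ $\geq$-upward closed, $V(p)\subseteq L(p)$. The language at $\omega$ is $\mathcal{L}^{A,K}(\omega):=\mathcal{L}^{A,K}(\{p\mid\omega\in L(p)\})$. Truth at $\omega$ is defined only for $\phi\in\mathcal{L}^{A,K}(\omega)$ (otherwise $\langle M,\omega\rangle\not\models\phi$), recursively: $\langle M,\omega\rangle\models 1$ always; $\models p$ iff $\omega\in V(p)$; $\models\neg\phi$ iff $\langle M,\omega\rangle\not\models\phi$; $\models\phi\land\psi$ iff both $\phi$ and $\psi$ hold at $\omega$; $\models A\phi$ iff $\phi\in\mathcal{L}^{A,K}(\omega')$ for all $\omega'\in\mathrm{R}(\omega)$; $\models K\phi$ iff $\langle M,\omega'\rangle\models\phi$ for all $\omega'\in\mathrm{R}(\omega)$. For every formula, $V(\phi)=\{\omega\mid\langle M,\omega\rangle\models\phi\}$ and $L(\phi)=\{\omega\mid\phi\in\mathcal{L}^{A,K}(\omega)\}$; in the claim, $L^h(\phi)$ and $V^h(\phi)$ are these sets for the model $M$ with $L=L^h$, $V=V^h$. -}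

module Defs where

open import Level using (Level; _⊔_; Lift; lift; lower) renaming (suc to lsuc)
open import Algebra.Core using (Op₁; Op₂)
import Algebra.Definitions as AlgebraDefinitions
open import Axiom.ExcludedMiddle using (ExcludedMiddle)
open import Data.Empty using (⊥-elim)
open import Data.Product using (∃; _×_; _,_; proj₁; proj₂)
open import Data.Sum using (_⊎_; inj₁; inj₂)
open import Data.Unit.Polymorphic using (⊤)
open import Function using (id)
open import Relation.Binary.Bundles using (Poset; Setoid)
open import Relation.Binary.Core using (Rel; _Preserves_⟶_)
open import Relation.Binary.Structures using (IsEquivalence; IsPreorder)
open import Relation.Binary.PropositionalEquality using (_≡_; refl)
import Relation.Binary.PropositionalEquality.Properties as ≡
import Relation.Binary.Reasoning.Setoid as SetoidReasoning
open import Relation.Nullary using (yes; no; ¬_)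
open import Relation.Nullary.Decidable using (map′; True; toWitness; fromWitness)
open import Relation.Unary using (Pred; _∈_; _∉_; _⊆_; _⊇_; _⊂_; _≐_; _∩_)

private
  variable
    a c c′ ℓ ℓ′ p w r l : Level

-- The empty chain is included, so the hypothesis makes P nonempty.
Zorn : (a ℓ₁ ℓ₂ c : Level) → Set (lsuc (a ⊔ ℓ₁ ⊔ ℓ₂ ⊔ c))
Zorn a ℓ₁ ℓ₂ c =
  (P : Poset a ℓ₁ ℓ₂) → let open Poset P in
  ((C : Pred Carrier c) →
   (∀ {x y} → x ∈ C → y ∈ C → x ≤ y ⊎ y ≤ x) →
   ∃ λ b → ∀ {x} → x ∈ C → x ≤ b) →
  ∃ λ m → ∀ {x} → m ≤ x → m ≈ x

record RawBooleanAlgebra c ℓ : Set (lsuc (c ⊔ ℓ)) where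
  infix  8 ~_
  infixr 7 _∧_
  infixr 6 _∨_
  infix  4 _≈_ _≥_
  field
    Carrier : Set c
    _≈_     : Rel Carrier ℓ
    _∧_     : Op₂ Carrier
    _∨_     : Op₂ Carrier
    ~_      : Op₁ Carrier
    0#      : Carrier
    1#      : Carrier

  1[_] : Op₁ Carrier
  1[ x ] = x ∨ ~ x

  0[_] : Op₁ Carrier
  0[ x ] = x ∧ ~ x

  _≥_ : Rel Carrier ℓ
  y ≥ x = x ∧ y ≈ x

-- Preservation of 0# is not required.
record Homomorphism (A : RawBooleanAlgebra c ℓ) (B : RawBooleanAlgebra c′ ℓ′)
                    : Set (c ⊔ ℓ ⊔ c′ ⊔ ℓ′) where
  private
    module A = RawBooleanAlgebra A
    module B = RawBooleanAlgebra B
  field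
    ⟦_⟧    : A.Carrier → B.Carrier
    ⟦⟧-cong : ⟦_⟧ Preserves A._≈_ ⟶ B._≈_
    1-homo : ⟦ A.1# ⟧ B.≈ B.1#
    ∧-homo : ∀ x y → ⟦ x A.∧ y ⟧ B.≈ ⟦ x ⟧ B.∧ ⟦ y ⟧
    ∨-homo : ∀ x y → ⟦ x A.∨ y ⟧ B.≈ ⟦ x ⟧ B.∨ ⟦ y ⟧
    ~-homo : ∀ x → ⟦ A.~ x ⟧ B.≈ B.~ ⟦ x ⟧

-- Upward closure makes every filter respect _≈_ in the algebras used below.
module _ (A : RawBooleanAlgebra c ℓ) where
  open RawBooleanAlgebra A

  record IsFilter (F : Pred Carrier p) : Set (c ⊔ ℓ ⊔ p) where
    field
      top  : 1# ∈ F
      up   : ∀ {x y} → y ≥ x → x ∈ F → y ∈ F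
      meet : ∀ {x y} → x ∈ F → y ∈ F → x ∧ y ∈ F

  StronglyProper : Pred Carrier p → Set (c ⊔ p)
  StronglyProper F = ∀ x → x ∧ ~ x ∉ F

  record IsUltrafilter (F : Pred Carrier p) : Set (c ⊔ ℓ ⊔ lsuc p) where
    field
      isFilter       : IsFilter F
      stronglyProper : StronglyProper F
      maximal        : (G : Pred Carrier p) → IsFilter G → StronglyProper G → ¬ (F ⊂ G)

record IsRelativizedBooleanAlgebra (A : RawBooleanAlgebra c ℓ) : Set (c ⊔ ℓ) where
  open RawBooleanAlgebra A
  open AlgebraDefinitions _≈_
  field
    isEquivalence : IsEquivalence _≈_
    ∧-cong : Congruent₂ _∧_
    ∨-cong : Congruent₂ _∨_
    ~-cong : Congruent₁ ~_
    ∧-assoc       : Associative _∧_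
    ∨-assoc       : Associative _∨_
    ∧-comm        : Commutative _∧_
    ∨-comm        : Commutative _∨_
    ∧-distrib-∨   : _∧_ DistributesOver _∨_
    ∨-distrib-∧   : _∨_ DistributesOver _∧_
    deMorgan₁     : ∀ x y → ~ (x ∧ y) ≈ ~ x ∨ ~ y
    deMorgan₂     : ∀ x y → ~ (x ∨ y) ≈ ~ x ∧ ~ y
    ∧-idem        : Idempotent _∧_
    ∨-idem        : Idempotent _∨_
    ∧-identityʳ   : RightIdentity 1# _∧_
    ~-involutive  : Involutive ~_
    x∨1≈1[x]      : ∀ x → x ∨ 1# ≈ 1[ x ]
    ∧-zeroʳ       : RightZero 0# _∧_
    ~-restrict    : ∀ {x y} → x ≥ y → ~ (x ∧ 1[ y ]) ≈ ~ x ∧ 1[ y ]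

record RelativizedBooleanAlgebra c ℓ : Set (lsuc (c ⊔ ℓ)) where
  field
    raw  : RawBooleanAlgebra c ℓ
    isRBA : IsRelativizedBooleanAlgebra raw
  open RawBooleanAlgebra raw public
  open IsRelativizedBooleanAlgebra isRBA public

  setoid : Setoid c ℓ
  setoid = record { isEquivalence = isEquivalence }
  open IsEquivalence isEquivalence public
    renaming (refl to ≈-refl; sym to ≈-sym; trans to ≈-trans)

module RBAProperties (RB : RelativizedBooleanAlgebra c ℓ) where
  open RelativizedBooleanAlgebra RB
  open SetoidReasoning setoid

  1[]-cong : ∀ {x y} → x ≈ y → 1[ x ] ≈ 1[ y ]
  1[]-cong e = ∨-cong e (~-cong e)

  1[~] : ∀ x → 1[ ~ x ] ≈ 1[ x ]
  1[~] x = begin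
    ~ x ∨ ~ ~ x ≈⟨ ∨-cong ≈-refl (~-involutive x) ⟩
    ~ x ∨ x     ≈⟨ ∨-comm _ _ ⟩
    x ∨ ~ x     ∎

  1[∧] : ∀ x y → 1[ x ∧ y ] ≈ 1[ x ] ∧ 1[ y ]
  1[∧] x y = begin
    1[ x ∧ y ]            ≈⟨ x∨1≈1[x] _ ⟨
    x ∧ y ∨ 1#            ≈⟨ proj₂ ∨-distrib-∧ _ _ _ ⟩
    (x ∨ 1#) ∧ (y ∨ 1#)   ≈⟨ ∧-cong (x∨1≈1[x] x) (x∨1≈1[x] y) ⟩
    1[ x ] ∧ 1[ y ]       ∎

  1[∨] : ∀ x y → 1[ x ∨ y ] ≈ 1[ x ] ∧ 1[ y ]
  1[∨] x y = begin
    1[ x ∨ y ]          ≈⟨ 1[~] _ ⟨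
    1[ ~ (x ∨ y) ]      ≈⟨ 1[]-cong (deMorgan₂ x y) ⟩
    1[ ~ x ∧ ~ y ]      ≈⟨ 1[∧] _ _ ⟩
    1[ ~ x ] ∧ 1[ ~ y ] ≈⟨ ∧-cong (1[~] x) (1[~] y) ⟩
    1[ x ] ∧ 1[ y ]     ∎

  1[1[]] : ∀ x → 1[ 1[ x ] ] ≈ 1[ x ]
  1[1[]] x = begin
    1[ x ∨ ~ x ]      ≈⟨ 1[∨] _ _ ⟩
    1[ x ] ∧ 1[ ~ x ] ≈⟨ ∧-cong ≈-refl (1[~] x) ⟩
    1[ x ] ∧ 1[ x ]   ≈⟨ ∧-idem _ ⟩
    1[ x ]            ∎

  1[0[]] : ∀ x → 1[ 0[ x ] ] ≈ 1[ x ]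
  1[0[]] x = begin
    1[ x ∧ ~ x ]      ≈⟨ 1[∧] _ _ ⟩
    1[ x ] ∧ 1[ ~ x ] ≈⟨ ∧-cong ≈-refl (1[~] x) ⟩
    1[ x ] ∧ 1[ x ]   ≈⟨ ∧-idem _ ⟩
    1[ x ]            ∎

-- π₁ x carries the inherited operations, but its top and bottom are 1[ x ] and
-- 0[ x ]: a filter of π₁ x must contain 1[ x ], not the 1# of RB.
module _ (RB : RelativizedBooleanAlgebra c ℓ) where
  open RelativizedBooleanAlgebra RB
  open RBAProperties RB

  π₂ : Pred Carrier (c ⊔ ℓ)
  π₂ z = ∃ λ x → z ≈ 1[ x ]

  π₁ : Carrier → RawBooleanAlgebra (c ⊔ ℓ) ℓ
  π₁ x = record
    { Carrier = ∃ λ z → 1[ z ] ≈ 1[ x ]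
    ; _≈_     = λ (y , _) (z , _) → y ≈ z
    ; _∧_     = λ (y , e) (z , e′) → y ∧ z ,
                ≈-trans (1[∧] y z) (≈-trans (∧-cong e e′) (∧-idem _))
    ; _∨_     = λ (y , e) (z , e′) → y ∨ z ,
                ≈-trans (1[∨] y z) (≈-trans (∧-cong e e′) (∧-idem _))
    ; ~_      = λ (y , e) → ~ y , ≈-trans (1[~] y) e
    ; 0#      = 0[ x ] , 1[0[]] x
    ; 1#      = 1[ x ] , 1[1[]] x
    }

  π₂-restrict : Pred Carrier p → Pred Carrier (c ⊔ ℓ ⊔ p)
  π₂-restrict u = u ∩ π₂

  π₁-restrict : Pred Carrier p → (x : Carrier) → Pred (RawBooleanAlgebra.Carrier (π₁ x)) p
  π₁-restrict u x (z , _) = z ∈ u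

  record IsWorld (u : Pred Carrier (c ⊔ ℓ)) : Set (lsuc (c ⊔ ℓ)) where
    field
      isFilter    : IsFilter raw u
      ultrafilter : ∀ {x} → x ∈ π₂-restrict u → IsUltrafilter (π₁ x) (π₁-restrict u x)

  -- World is the set F^RB.
  World : Set (lsuc (c ⊔ ℓ))
  World = ∃ IsWorld

record MRBAᵏ c ℓ : Set (lsuc (c ⊔ ℓ)) where
  field
    RB : RelativizedBooleanAlgebra c ℓ
  open RelativizedBooleanAlgebra RB public
  field
    fᵏ      : Op₁ Carrier
    fᵏ-cong : fᵏ Preserves _≈_ ⟶ _≈_
    f1      : fᵏ 1# ≈ 1#
    f2      : ∀ x y → fᵏ (x ∧ y) ≈ fᵏ x ∧ fᵏ y
    fD      : ∀ x → fᵏ 0[ x ] ≈ 0[ x ]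
    fk      : ∀ x → 1[ fᵏ x ] ≈ 1[ x ]

  fᴬ : Op₁ Carrier
  fᴬ x = fᵏ 1[ x ]

infix  8 ‵¬_
infixr 7 _‵∧_ _‵∨_

data 𝓛 (ℙ : Set a) : Set a where
  var  : ℙ → 𝓛 ℙ
  ‵1   : 𝓛 ℙ
  ‵¬_  : 𝓛 ℙ → 𝓛 ℙ
  _‵∧_ : 𝓛 ℙ → 𝓛 ℙ → 𝓛 ℙ

‵0 : {ℙ : Set a} → 𝓛 ℙ
‵0 = ‵¬ ‵1

_‵∨_ : {ℙ : Set a} → 𝓛 ℙ → 𝓛 ℙ → 𝓛 ℙ
φ ‵∨ ψ = ‵¬ (‵¬ φ ‵∧ ‵¬ ψ)

𝓛-algebra : Set a → RawBooleanAlgebra a a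
𝓛-algebra ℙ = record
  { Carrier = 𝓛 ℙ
  ; _≈_     = _≡_
  ; _∧_     = _‵∧_
  ; _∨_     = _‵∨_
  ; ~_      = ‵¬_
  ; 0#      = ‵0
  ; 1#      = ‵1
  }

data 𝓛ᴬᴷ (ℙ : Set a) : Set a where
  var  : ℙ → 𝓛ᴬᴷ ℙ
  ‵1   : 𝓛ᴬᴷ ℙ
  ‵¬_  : 𝓛ᴬᴷ ℙ → 𝓛ᴬᴷ ℙ
  _‵∧_ : 𝓛ᴬᴷ ℙ → 𝓛ᴬᴷ ℙ → 𝓛ᴬᴷ ℙ
  A K  : 𝓛ᴬᴷ ℙ → 𝓛ᴬᴷ ℙ

embed : {ℙ : Set a} → 𝓛 ℙ → 𝓛ᴬᴷ ℙ
embed (var q)  = var q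
embed ‵1       = ‵1
embed (‵¬ φ)   = ‵¬ embed φ
embed (φ ‵∧ ψ) = embed φ ‵∧ embed ψ

-- 𝓛ᴬᴷ(Q) for a set Q ⊆ ℙ of variables, as a set of formulas over ℙ.
data 𝓛ᴬᴷ⟨_⟩ {ℙ : Set a} (Q : Pred ℙ p) : Pred (𝓛ᴬᴷ ℙ) (a ⊔ p) where
  var  : ∀ {q} → q ∈ Q → var q ∈ 𝓛ᴬᴷ⟨ Q ⟩
  ‵1   : ‵1 ∈ 𝓛ᴬᴷ⟨ Q ⟩
  ‵¬_  : ∀ {φ} → φ ∈ 𝓛ᴬᴷ⟨ Q ⟩ → ‵¬ φ ∈ 𝓛ᴬᴷ⟨ Q ⟩
  _‵∧_ : ∀ {φ ψ} → φ ∈ 𝓛ᴬᴷ⟨ Q ⟩ → ψ ∈ 𝓛ᴬᴷ⟨ Q ⟩ → φ ‵∧ ψ ∈ 𝓛ᴬᴷ⟨ Q ⟩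
  A    : ∀ {φ} → φ ∈ 𝓛ᴬᴷ⟨ Q ⟩ → A φ ∈ 𝓛ᴬᴷ⟨ Q ⟩
  K    : ∀ {φ} → φ ∈ 𝓛ᴬᴷ⟨ Q ⟩ → K φ ∈ 𝓛ᴬᴷ⟨ Q ⟩

module Extension {ℙ : Set a} (M : MRBAᵏ c ℓ)
                 (h : Homomorphism (𝓛-algebra ℙ) (MRBAᵏ.raw M)) where
  open MRBAᵏ M
  open Homomorphism h

  h⁺ : 𝓛ᴬᴷ ℙ → Carrier
  h⁺ (var q)  = ⟦ var q ⟧
  h⁺ ‵1       = 1#
  h⁺ (‵¬ φ)   = ~ h⁺ φ
  h⁺ (φ ‵∧ ψ) = h⁺ φ ∧ h⁺ ψ
  h⁺ (A φ)    = fᴬ (h⁺ φ)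
  h⁺ (K φ)    = fᵏ (h⁺ φ)

  h⁺-extends : ∀ φ → h⁺ (embed φ) ≈ ⟦ φ ⟧
  h⁺-extends (var q)  = ≈-refl
  h⁺-extends ‵1       = ≈-sym 1-homo
  h⁺-extends (‵¬ φ)   = ≈-trans (~-cong (h⁺-extends φ)) (≈-sym (~-homo φ))
  h⁺-extends (φ ‵∧ ψ) =
    ≈-trans (∧-cong (h⁺-extends φ) (h⁺-extends ψ)) (≈-sym (∧-homo φ ψ))

record OrderedFrame w r : Set (lsuc (w ⊔ r)) where
  infix 4 _≥_ _R_
  field
    W          : Set w
    _≥_        : Rel W r
    _R_        : Rel W r
    isPreorder : IsPreorder _≡_ _≥_
    serial     : ∀ ω → ∃ λ ω′ → ω R ω′

record AwarenessModel (ℙ : Set a) w r l : Set (a ⊔ lsuc (w ⊔ r ⊔ l)) where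
  field
    frame : OrderedFrame w r
  open OrderedFrame frame public
  field
    L V      : ℙ → Pred W l
    L-upward : ∀ q {ω ω′} → ω′ ≥ ω → ω ∈ L q → ω′ ∈ L q
    V⊆L      : ∀ q → V q ⊆ L q

module _ {ℙ : Set a} (M : AwarenessModel ℙ w r l) where
  open AwarenessModel M

  languageAt : W → Pred (𝓛ᴬᴷ ℙ) (a ⊔ l)
  languageAt ω = 𝓛ᴬᴷ⟨ (λ q → ω ∈ L q) ⟩

  -- A formula outside the language at ω is not true at ω; inside it, truth
  -- is given by the recursive clauses.
  mutual
    Truth : W → 𝓛ᴬᴷ ℙ → Set (a ⊔ w ⊔ r ⊔ l)
    Truth ω φ = φ ∈ languageAt ω × Clause ω φ

    Clause : W → 𝓛ᴬᴷ ℙ → Set (a ⊔ w ⊔ r ⊔ l)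
    Clause ω (var q)  = Lift (a ⊔ w ⊔ r ⊔ l) (ω ∈ V q)
    Clause ω ‵1       = ⊤
    Clause ω (‵¬ φ)   = ¬ Truth ω φ
    Clause ω (φ ‵∧ ψ) = Truth ω φ × Truth ω ψ
    Clause ω (A φ)    = Lift (a ⊔ w ⊔ r ⊔ l) (∀ ω′ → ω R ω′ → φ ∈ languageAt ω′)
    Clause ω (K φ)    = ∀ ω′ → ω R ω′ → Truth ω′ φ

  L⟦_⟧ : 𝓛ᴬᴷ ℙ → Pred W (a ⊔ l)
  L⟦ φ ⟧ ω = φ ∈ languageAt ω

  V⟦_⟧ : 𝓛ᴬᴷ ℙ → Pred W (a ⊔ w ⊔ r ⊔ l)
  V⟦ φ ⟧ ω = Truth ω φ

-- `extend`: every strongly proper filter extends to a world with the same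
-- π₂-part. It is what makes the canonical accessibility relation serial.
module FilterExtension (RB : RelativizedBooleanAlgebra c ℓ) where
  open RelativizedBooleanAlgebra RB
  open RBAProperties RB
  open SetoidReasoning setoid
  open IsFilter

  private
    𝓅 : Level
    𝓅 = c ⊔ ℓ

  ≥-reflexive : ∀ {x y} → x ≈ y → y ≥ x
  ≥-reflexive e = ≈-trans (∧-cong ≈-refl (≈-sym e)) (∧-idem _)

  ≥-trans : ∀ {x y z} → x ≥ y → y ≥ z → x ≥ z
  ≥-trans {x} {y} {z} p q = begin
    z ∧ x       ≈⟨ ∧-cong q ≈-refl ⟨
    (z ∧ y) ∧ x ≈⟨ ∧-assoc _ _ _ ⟩
    z ∧ (y ∧ x) ≈⟨ ∧-cong ≈-refl p ⟩
    z ∧ y       ≈⟨ q ⟩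
    z           ∎

  ∧-lowerʳ : ∀ {x y} → y ≥ x ∧ y
  ∧-lowerʳ = ≈-trans (∧-assoc _ _ _) (∧-cong ≈-refl (∧-idem _))

  ∧-lowerˡ : ∀ {x y} → x ≥ x ∧ y
  ∧-lowerˡ = ≥-trans ∧-lowerʳ (≥-reflexive (∧-comm _ _))

  ∧-greatest : ∀ {x y z} → x ≥ z → y ≥ z → x ∧ y ≥ z
  ∧-greatest p q = ≈-trans (≈-sym (∧-assoc _ _ _)) (≈-trans (∧-cong p ≈-refl) q)

  1[]-mono : ∀ {x y} → y ≥ x → 1[ y ] ≥ 1[ x ]
  1[]-mono p = ≈-trans (≈-sym (1[∧] _ _)) (1[]-cong p)

  1[x]≥x : ∀ x → 1[ x ] ≥ x
  1[x]≥x x = begin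
    x ∧ 1[ x ]         ≈⟨ ∧-cong ≈-refl (x∨1≈1[x] x) ⟨
    x ∧ (x ∨ 1#)       ≈⟨ proj₁ ∧-distrib-∨ _ _ _ ⟩
    (x ∧ x) ∨ (x ∧ 1#) ≈⟨ ∨-cong (∧-idem x) (∧-identityʳ x) ⟩
    x ∨ x              ≈⟨ ∨-idem x ⟩
    x                  ∎

  ∈π₂ : ∀ {x} → x ∈ π₂ RB → 1[ x ] ≈ x
  ∈π₂ (y , e) = ≈-trans (1[]-cong e) (≈-trans (1[1[]] y) (≈-sym e))

  0[]-cong-1[] : ∀ {x y} → 1[ x ] ≈ 1[ y ] → 0[ x ] ≈ 0[ y ]
  0[]-cong-1[] {x} {y} e = ≈-trans (lem x) (≈-trans (~-cong e) (≈-sym (lem y)))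
    where
    lem : ∀ z → 0[ z ] ≈ ~ 1[ z ]
    lem z = begin
      z ∧ ~ z     ≈⟨ ∧-comm _ _ ⟩
      ~ z ∧ z     ≈⟨ ∧-cong ≈-refl (~-involutive z) ⟨
      ~ z ∧ ~ ~ z ≈⟨ deMorgan₂ _ _ ⟨
      ~ (z ∨ ~ z) ∎

  1[x∧1[y]] : ∀ {x y} → x ≥ y → 1[ x ∧ 1[ y ] ] ≈ 1[ y ]
  1[x∧1[y]] {x} {y} p = begin
    1[ x ∧ 1[ y ] ]      ≈⟨ 1[∧] _ _ ⟩
    1[ x ] ∧ 1[ 1[ y ] ] ≈⟨ ∧-cong ≈-refl (1[1[]] y) ⟩
    1[ x ] ∧ 1[ y ]      ≈⟨ ∧-comm _ _ ⟩
    1[ y ] ∧ 1[ x ]      ≈⟨ 1[]-mono p ⟩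
    1[ y ]               ∎

  ~x≥0[y] : ∀ {x y} → x ≥ y → ~ x ≥ 0[ y ]
  ~x≥0[y] p =
    ≥-trans (≥-trans ∧-lowerˡ (≥-reflexive (~-restrict p)))
            (≥-trans ∧-lowerʳ (≥-reflexive (≈-sym (0[]-cong-1[] (1[x∧1[y]] p)))))

  0[]-least : ∀ {x y} → 0[ x ] ≥ y → 0[ y ] ≥ y
  0[]-least {x} {y} p =
    ≥-trans (≥-reflexive (0[]-cong-1[] (1[x∧1[y]] x≥y)))
            (∧-greatest (∧-greatest x≥y (1[x]≥x y))
                        (≥-trans (≥-reflexive (≈-sym (~-restrict x≥y)))
                                 (∧-greatest (≥-trans ∧-lowerʳ p) (1[x]≥x y))))
    where
    x≥y : x ≥ y
    x≥y = ≥-trans ∧-lowerˡ p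

  generated : Pred Carrier 𝓅 → Carrier → Pred Carrier 𝓅
  generated u z y = ∃ λ x → x ∈ u × y ≥ x ∧ z

  module _ {u : Pred Carrier 𝓅} (F : IsFilter raw u) where

    generated-isFilter : ∀ z → IsFilter raw (generated u z)
    generated-isFilter z = record
      { top  = 1# , top F , ∧-identityʳ _
      ; up   = λ { q (x , x∈u , p) → x , x∈u , ≥-trans q p }
      ; meet = λ { (x , x∈u , p) (y , y∈u , q) →
          x ∧ y , meet F x∈u y∈u ,
          ∧-greatest (≥-trans p (∧-greatest (≥-trans ∧-lowerˡ ∧-lowerˡ) ∧-lowerʳ))
                     (≥-trans q (∧-greatest (≥-trans ∧-lowerʳ ∧-lowerˡ) ∧-lowerʳ)) }
      }

    generated-⊇ : ∀ z → u ⊆ generated u z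
    generated-⊇ z x∈u = _ , x∈u , ∧-lowerˡ

    generated-∋ : ∀ z → z ∈ generated u z
    generated-∋ z = 1# , top F , ∧-lowerʳ

    generated-π₂ : ∀ {z} → 1[ z ] ∈ u → π₂-restrict RB (generated u z) ⊆ u
    generated-π₂ 1z∈u ((x , x∈u , p) , y∈π₂) =
      up F (≥-trans (≥-reflexive (∈π₂ y∈π₂)) (≥-trans (1[]-mono p)
             (≥-reflexive (≈-sym (1[∧] _ _)))))
           (meet F (up F (1[x]≥x _) x∈u) 1z∈u)

    generated-improper : ∀ {z y} → 1[ z ] ∈ u → 0[ y ] ∈ generated u z → ~ z ∈ u
    generated-improper {z} 1z∈u (x , x∈u , p) = up F lem (meet F x∈u 1z∈u)
      where
      ~z≥x∧z : ~ z ≥ x ∧ z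
      ~z≥x∧z = ≥-trans (~x≥0[y] ∧-lowerʳ) (0[]-least p)

      lem : ~ z ≥ x ∧ 1[ z ]
      lem = begin
        (x ∧ (z ∨ ~ z)) ∧ ~ z               ≈⟨ ∧-cong (proj₁ ∧-distrib-∨ _ _ _) ≈-refl ⟩
        ((x ∧ z) ∨ (x ∧ ~ z)) ∧ ~ z         ≈⟨ proj₂ ∧-distrib-∨ _ _ _ ⟩
        ((x ∧ z) ∧ ~ z) ∨ ((x ∧ ~ z) ∧ ~ z) ≈⟨ ∨-cong ~z≥x∧z ∧-lowerʳ ⟩
        (x ∧ z) ∨ (x ∧ ~ z)                 ≈⟨ proj₁ ∧-distrib-∨ _ _ _ ⟨
        x ∧ (z ∨ ~ z)                       ∎

  module _ (em   : ExcludedMiddle (lsuc 𝓅))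
           (zorn : Zorn (lsuc 𝓅) 𝓅 𝓅 (lsuc 𝓅))
           {u : Pred Carrier 𝓅} (uF : IsFilter raw u) (uP : StronglyProper raw u) where

    private
      em↓ : ExcludedMiddle 𝓅
      em↓ = map′ lower lift (em {Lift (lsuc 𝓅) _})

      record Candidate : Set (lsuc 𝓅) where
        field
          set    : Pred Carrier 𝓅
          filter : IsFilter raw set
          proper : StronglyProper raw set
          above  : u ⊆ set
          below  : π₂-restrict RB set ⊆ u
      open Candidate

      candidates : Poset (lsuc 𝓅) 𝓅 𝓅
      candidates = record
        { Carrier = Candidate
        ; _≈_ = λ v v′ → set v ≐ set v′
        ; _≤_ = λ v v′ → set v ⊆ set v′
        ; isPartialOrder = record
          { isPreorder = record
            { isEquivalence = record
              { refl  = id , id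
              ; sym   = λ (p , q) → q , p
              ; trans = λ (p , q) (p′ , q′) → (λ m → p′ (p m)) , (λ m → q (q′ m))
              }
            ; reflexive = proj₁
            ; trans = λ p q m → q (p m)
            }
          ; antisym = λ p q → p , q
          }
        }

      base : Candidate
      base = record { set = u ; filter = uF ; proper = uP ; above = id ; below = proj₁ }

      module Bound (C : Pred Candidate (lsuc 𝓅))
                   (chain : ∀ {v v′} → v ∈ C → v′ ∈ C → set v ⊆ set v′ ⊎ set v′ ⊆ set v) where

        Member : Pred Carrier (lsuc 𝓅)
        Member x = ∃ λ v → (v ∈ C ⊎ v ≡ base) × x ∈ set v

        -- Excluded middle brings the union down to the level of its members.
        union : Pred Carrier 𝓅
        union x = Lift 𝓅 (True (em {Member x}))

        out : ∀ {x} → x ∈ union → Member x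
        out (lift m) = toWitness m

        into : ∀ {x} → Member x → x ∈ union
        into m = lift (fromWitness m)

        meetᴹ : ∀ {x y} → Member x → Member y → Member (x ∧ y)
        meetᴹ (v , inj₁ i , m) (v′ , inj₁ j , n) with chain i j
        ... | inj₁ le = v′ , inj₁ j , meet (filter v′) (le m) n
        ... | inj₂ le = v , inj₁ i , meet (filter v) m (le n)
        meetᴹ (v , i , m) (_ , inj₂ refl , n) = v , i , meet (filter v) m (above v n)
        meetᴹ (_ , inj₂ refl , m) (v , j , n) = v , j , meet (filter v) (above v m) n

        bound : Candidate
        bound = record
          { set    = union
          ; filter = record
            { top  = into (base , inj₂ refl , top uF)
            ; up   = λ le m → let (v , i , n) = out m in into (v , i , up (filter v) le n)
            ; meet = λ m n → into (meetᴹ (out m) (out n))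
            }
          ; proper = λ x m → let (v , _ , n) = out m in proper v x n
          ; above  = λ m → into (base , inj₂ refl , m)
          ; below  = λ (m , e) → let (v , _ , n) = out m in below v (n , e)
          }

      maximum : ∃ λ v → ∀ {v′} → set v ⊆ set v′ → set v ≐ set v′
      maximum = zorn candidates λ C chain →
        let open Bound C chain in bound , λ {v} i m → into (v , inj₁ i , m)

      v : Candidate
      v = proj₁ maximum

      decides : ∀ z → 1[ z ] ∈ set v → z ∈ set v ⊎ ~ z ∈ set v
      decides z 1z∈v with em↓ {~ z ∈ set v}
      ... | yes m = inj₂ m
      ... | no ~z∉v = inj₁ (proj₂ (proj₂ maximum {v′} (generated-⊇ (filter v) z))
                                  (generated-∋ (filter v) z))
        where
        v′ : Candidate
        v′ = record
          { set    = generated (set v) z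
          ; filter = generated-isFilter (filter v) z
          ; proper = λ y m → ~z∉v (generated-improper (filter v) 1z∈v m)
          ; above  = λ m → generated-⊇ (filter v) z (above v m)
          ; below  = λ (m , e) → below v (generated-π₂ (filter v) 1z∈v (m , e) , e)
          }

      ultra : ∀ {x} → x ∈ π₂-restrict RB (set v) →
              IsUltrafilter (π₁ RB x) (π₁-restrict RB (set v) x)
      ultra {x} (x∈v , _) = record
        { isFilter = record
          { top  = 1x∈v
          ; up   = up (filter v)
          ; meet = meet (filter v)
          }
        ; stronglyProper = λ (y , _) → proper v y
        ; maximal = λ G GF GP (v⊆G , G⊈v) → G⊈v λ {z} z∈G → member G GF GP v⊆G z z∈G
        }
        where
        1x∈v : 1[ x ] ∈ set v
        1x∈v = up (filter v) (1[x]≥x x) x∈v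

        member : (G : Pred (RawBooleanAlgebra.Carrier (π₁ RB x)) 𝓅) →
                 IsFilter (π₁ RB x) G → StronglyProper (π₁ RB x) G →
                 π₁-restrict RB (set v) x ⊆ G →
                 ∀ z → z ∈ G → proj₁ z ∈ set v
        member G GF GP v⊆G (z , e) z∈G
          with decides z (up (filter v) (≥-reflexive (≈-sym e)) 1x∈v)
        ... | inj₁ m = m
        ... | inj₂ m = ⊥-elim (GP (z , e) (meet GF z∈G (v⊆G m)))

    extend : ∃ λ (v : World RB) → u ⊆ proj₁ v × π₂-restrict RB (proj₁ v) ⊆ u
    extend = (set v , record { isFilter = filter v ; ultrafilter = ultra }) , above v , below v

module Canonical {ℙ : Set a} (M : MRBAᵏ c ℓ)
                 (h : Homomorphism (𝓛-algebra ℙ) (MRBAᵏ.raw M)) where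
  open MRBAᵏ M
  open Homomorphism h
  open FilterExtension RB
  open IsFilter

  infix 4 _≥ᴿᴮ_ _Rᴿᴮ_

  _≥ᴿᴮ_ : Rel (World RB) (c ⊔ ℓ)
  (u , _) ≥ᴿᴮ (v , _) = π₂-restrict RB u ⊇ π₂-restrict RB v

  _Rᴿᴮ_ : Rel (World RB) (c ⊔ ℓ)
  (u , _) Rᴿᴮ (v , _) = ∀ x → fᵏ x ∈ u → x ∈ v

  Lʰ : ℙ → Pred (World RB) (c ⊔ ℓ)
  Lʰ q (u , _) = 1[ ⟦ var q ⟧ ] ∈ u

  Vʰ : ℙ → Pred (World RB) (c ⊔ ℓ)
  Vʰ q (u , _) = ⟦ var q ⟧ ∈ u

  module _ (u : World RB) where
    private
      uF : IsFilter raw (proj₁ u)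
      uF = IsWorld.isFilter (proj₂ u)

    world-proper : StronglyProper raw (proj₁ u)
    world-proper x m = IsUltrafilter.stronglyProper
      (IsWorld.ultrafilter (proj₂ u) {1[ x ]} (1x∈u , x , ≈-refl))
      (x , ≈-sym (RBAProperties.1[1[]] RB x)) m
      where
      1x∈u : 1[ x ] ∈ proj₁ u
      1x∈u = up uF (≥-trans (1[x]≥x x) ∧-lowerˡ) m

    fᵏ⁻¹ : Pred Carrier (c ⊔ ℓ)
    fᵏ⁻¹ x = fᵏ x ∈ proj₁ u

    fᵏ⁻¹-isFilter : IsFilter raw fᵏ⁻¹
    fᵏ⁻¹-isFilter = record
      { top  = up uF (≥-reflexive (≈-sym f1)) (top uF)
      ; up   = λ le → up uF (≈-trans (≈-sym (f2 _ _)) (fᵏ-cong le))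
      ; meet = λ m n → up uF (≥-reflexive (≈-sym (f2 _ _))) (meet uF m n)
      }

    fᵏ⁻¹-proper : StronglyProper raw fᵏ⁻¹
    fᵏ⁻¹-proper x m = world-proper x (up uF (≥-reflexive (fD x)) m)

  -- Only the proof of seriality uses em and zorn.
  canonicalModel : ExcludedMiddle (lsuc (c ⊔ ℓ)) →
                   Zorn (lsuc (c ⊔ ℓ)) (c ⊔ ℓ) (c ⊔ ℓ) (lsuc (c ⊔ ℓ)) →
                   AwarenessModel ℙ (lsuc (c ⊔ ℓ)) (c ⊔ ℓ) (c ⊔ ℓ)
  canonicalModel em zorn = record
    { frame = record
      { W   = World RB
      ; _≥_ = _≥ᴿᴮ_
      ; _R_ = _Rᴿᴮ_
      ; isPreorder = record
        { isEquivalence = ≡.isEquivalence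
        ; reflexive     = λ { refl → id }
        ; trans         = λ p q m → p (q m)
        }
      ; serial = λ u →
          let v , fᵏ⁻¹⊆v , _ = extend em zorn (fᵏ⁻¹-isFilter u) (fᵏ⁻¹-proper u)
          in v , λ _ → fᵏ⁻¹⊆v
      }
    ; L = Lʰ
    ; V = Vʰ
    ; L-upward = λ q ω′≥ω m → proj₁ (ω′≥ω (m , ⟦ var q ⟧ , ≈-refl))
    ; V⊆L = λ q {u} → up (IsWorld.isFilter (proj₂ u)) (1[x]≥x ⟦ var q ⟧)
    }

{-# OPTIONS --safe #-}

-- Induction on φ. The cases ¬ and K are the substantial ones. For ¬, a world
-- containing 1[ x ] contains x or ~ x, since its trace on π₁ x is an ultrafilter.
-- For K, if fᵏ x ∉ u, then some world v with u R v omits x: extend the filter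
-- { y ∣ fᵏ y ∈ u }, after adjoining ~ x to it in case it contains 1[ x ].

module Submission where

open import Level using (Level; _⊔_; Lift; lift; lower; suc)
open import Axiom.ExcludedMiddle using (ExcludedMiddle)
open import Axiom.DoubleNegationElimination using (em⇒dne)
open import Data.Product using (_×_; _,_; proj₁; proj₂)
open import Data.Unit.Polymorphic using (tt)
open import Relation.Nullary using (¬_; yes; no; contradiction)
open import Relation.Nullary.Decidable using (map′)
open import Relation.Unary using (Pred; _∈_; _∉_; _≐_)
open import Defs

private
  variable
    a c ℓ : Level

module WorldProperties {ℙ : Set a} (RBf : MRBAᵏ c ℓ)
                       (h : Homomorphism (𝓛-algebra ℙ) (MRBAᵏ.raw RBf))
                       (em : ExcludedMiddle (suc (c ⊔ ℓ))) where
  open MRBAᵏ RBf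
  open RBAProperties RB
  open FilterExtension RB
  open Canonical RBf h
  open IsFilter

  em↓ : ExcludedMiddle (c ⊔ ℓ)
  em↓ = map′ lower lift (em {Lift (suc (c ⊔ ℓ)) _})

  module _ (u : World RB) where
    private
      uF : IsFilter raw (proj₁ u)
      uF = IsWorld.isFilter (proj₂ u)

    world-resp : ∀ {x y} → x ≈ y → x ∈ proj₁ u → y ∈ proj₁ u
    world-resp e = up uF (≥-reflexive e)

    world-consistent : ∀ {x} → x ∈ proj₁ u → ~ x ∉ proj₁ u
    world-consistent x∈u ~x∈u = world-proper u _ (meet uF x∈u ~x∈u)

    -- Adjoining `x` to `u` gives a filter whose trace on the algebra of `1[ x ]` properly extends
    -- that of `u`. By maximality this trace is improper, which forces `~ x` into `u`.
    world-decides : ∀ {x} → 1[ x ] ∈ proj₁ u → x ∉ proj₁ u → ~ x ∈ proj₁ u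
    world-decides {x} 1x∈u x∉u = em⇒dne em↓ λ ~x∉u →
      IsUltrafilter.maximal
        (IsWorld.ultrafilter (proj₂ u) (1x∈u , x , ≈-refl))
        G G-isFilter
        (λ (y , _) 0y∈G → ~x∉u (generated-improper uF 1x∈u 0y∈G))
        ( (λ {z} → generated-⊇ uF x {proj₁ z})
        , λ G⊆u → x∉u (G⊆u {x , ≈-sym (1[1[]] x)} (generated-∋ uF x)) )
      where
      G : Pred (RawBooleanAlgebra.Carrier (π₁ RB 1[ x ])) (c ⊔ ℓ)
      G (z , _) = z ∈ generated (proj₁ u) x

      G-isFilter : IsFilter (π₁ RB 1[ x ]) G
      G-isFilter = record
        -- The top of this algebra is `1[ 1[ x ] ]`, which is only provably equal to `1[ x ]`.
        { top  = generated-⊇ uF x (world-resp (≈-sym (1[1[]] x)) 1x∈u)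
        ; up   = up (generated-isFilter uF x)
        ; meet = meet (generated-isFilter uF x)
        }

  module _ (zorn : Zorn (suc (c ⊔ ℓ)) (c ⊔ ℓ) (c ⊔ ℓ) (suc (c ⊔ ℓ))) (u : World RB) where

    -- The successors of `u` are exactly the worlds that include `fᵏ⁻¹ u`, so a successor omitting
    -- `x` is an extension of this filter. The lemma serves both modalities, as `fᴬ` is `fᵏ` applied
    -- to `1[ x ]`.
    ∈-successors⇒fᵏ∈ : ∀ {x} → (∀ v → u Rᴿᴮ v → x ∈ proj₁ v) → fᵏ x ∈ proj₁ u
    ∈-successors⇒fᵏ∈ {x} □x with em↓ {1[ x ] ∈ fᵏ⁻¹ u}
    -- `extend` adds no elements of `π₂`, so `x` in `v` would put `1[ x ]` back into `fᵏ⁻¹ u`.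
    ... | no 1x∉ = contradiction (below (up vF (1[x]≥x x) x∈v , x , ≈-refl)) 1x∉
      where
      ext = extend em zorn (fᵏ⁻¹-isFilter u) (fᵏ⁻¹-proper u)
      v = proj₁ ext
      vF = IsWorld.isFilter (proj₂ v)
      below = proj₂ (proj₂ ext)
      x∈v = □x v (λ _ → proj₁ (proj₂ ext))
    ... | yes 1x∈ = em⇒dne em↓ refute
      where
      F = fᵏ⁻¹-isFilter u

      refute : ¬ ¬ (x ∈ fᵏ⁻¹ u)
      refute x∉ =
        let v , g⊆v , _ = extend em zorn (generated-isFilter F (~ x)) g-proper
        in world-consistent v (□x v (λ _ m → g⊆v (generated-⊇ F (~ x) m)))
                              (g⊆v (generated-∋ F (~ x)))
        where
        g-proper : StronglyProper raw (generated (fᵏ⁻¹ u) (~ x))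
        -- If adjoining `~ x` made the filter improper, it would already contain `~ ~ x`, that is,
        -- `x`.
        g-proper y m = x∉ (up F (≥-reflexive (~-involutive x))
          (generated-improper F (up F (≥-reflexive (≈-sym (1[~] x))) 1x∈) m))

module TruthLemma {ℙ : Set a} (RBf : MRBAᵏ c ℓ)
                  (h : Homomorphism (𝓛-algebra ℙ) (MRBAᵏ.raw RBf))
                  (em : ExcludedMiddle (suc (c ⊔ ℓ)))
                  (zorn : Zorn (suc (c ⊔ ℓ)) (c ⊔ ℓ) (c ⊔ ℓ) (suc (c ⊔ ℓ))) where
  open MRBAᵏ RBf
  open RBAProperties RB
  open FilterExtension RB
  open Extension RBf h
  open Canonical RBf h
  open WorldProperties RBf h em
  open IsFilter

  private
    M : AwarenessModel ℙ _ _ _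
    M = canonicalModel em zorn

    filter : (u : World RB) → IsFilter raw (proj₁ u)
    filter u = IsWorld.isFilter (proj₂ u)

  1[fᴬ] : ∀ x → 1[ fᴬ x ] ≈ 1[ x ]
  1[fᴬ] x = ≈-trans (fk 1[ x ]) (1[1[]] x)

  -- No connective or modality alters relativization except by meets: `1[ h⁺ φ ]` is the meet of
  -- `1#` and the `1[ h⁺ (var q) ]` for the variables `q` of `φ`. The converse below rests on the
  -- same fact.
  language⇒∈ : ∀ φ u → φ ∈ languageAt M u → 1[ h⁺ φ ] ∈ proj₁ u
  language⇒∈ (var q)  u (var m)  = m
  language⇒∈ ‵1       u ‵1       = up (filter u) (1[x]≥x 1#) (top (filter u))
  language⇒∈ (‵¬ φ)   u (‵¬ m)   = world-resp u (≈-sym (1[~] _)) (language⇒∈ φ u m)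
  language⇒∈ (φ ‵∧ ψ) u (m ‵∧ n) = world-resp u (≈-sym (1[∧] _ _))
    (meet (filter u) (language⇒∈ φ u m) (language⇒∈ ψ u n))
  language⇒∈ (A φ)    u (A m)    = world-resp u (≈-sym (1[fᴬ] _)) (language⇒∈ φ u m)
  language⇒∈ (K φ)    u (K m)    = world-resp u (≈-sym (fk _)) (language⇒∈ φ u m)

  ∈⇒language : ∀ φ u → 1[ h⁺ φ ] ∈ proj₁ u → φ ∈ languageAt M u
  ∈⇒language (var q)  u m = var m
  ∈⇒language ‵1       u m = ‵1
  ∈⇒language (‵¬ φ)   u m = ‵¬ ∈⇒language φ u (world-resp u (1[~] _) m)
  ∈⇒language (φ ‵∧ ψ) u m =
    ∈⇒language φ u (up (filter u) ∧-lowerˡ m′) ‵∧ ∈⇒language ψ u (up (filter u) ∧-lowerʳ m′)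
    where
    m′ : 1[ h⁺ φ ] ∧ 1[ h⁺ ψ ] ∈ proj₁ u
    m′ = world-resp u (1[∧] _ _) m
  ∈⇒language (A φ)    u m = A (∈⇒language φ u (world-resp u (1[fᴬ] _) m))
  ∈⇒language (K φ)    u m = K (∈⇒language φ u (world-resp u (fk _) m))

  -- Both directions are proved in one induction because negation swaps them. `∈⇒clause` is split
  -- off since the language component of `Truth` is obtained uniformly from `1[ x ] ≥ x`.
  truth⇒∈ : ∀ φ u → Truth M u φ → h⁺ φ ∈ proj₁ u
  ∈⇒truth : ∀ φ u → h⁺ φ ∈ proj₁ u → Truth M u φ
  ∈⇒clause : ∀ φ u → h⁺ φ ∈ proj₁ u → Clause M u φ

  truth⇒∈ (var q)  u (_ , lift m)  = m
  truth⇒∈ ‵1       u _             = top (filter u)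
  truth⇒∈ (‵¬ φ)   u (‵¬ l , ¬t)   =
    world-decides u (language⇒∈ φ u l) λ m → ¬t (∈⇒truth φ u m)
  truth⇒∈ (φ ‵∧ ψ) u (_ , s , t)   = meet (filter u) (truth⇒∈ φ u s) (truth⇒∈ ψ u t)
  -- Awareness of `φ` at all successors says that each contains `1[ h⁺ φ ]`.
  truth⇒∈ (A φ)    u (_ , lift □l) = ∈-successors⇒fᵏ∈ zorn u λ v r → language⇒∈ φ v (□l v r)
  truth⇒∈ (K φ)    u (_ , □t)      = ∈-successors⇒fᵏ∈ zorn u λ v r → truth⇒∈ φ v (□t v r)

  ∈⇒truth φ u m = ∈⇒language φ u (up (filter u) (1[x]≥x (h⁺ φ)) m) , ∈⇒clause φ u m

  ∈⇒clause (var q)  u m = lift m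
  ∈⇒clause ‵1       u m = tt
  ∈⇒clause (‵¬ φ)   u m = λ t → world-consistent u (truth⇒∈ φ u t) m
  ∈⇒clause (φ ‵∧ ψ) u m =
    ∈⇒truth φ u (up (filter u) ∧-lowerˡ m) , ∈⇒truth ψ u (up (filter u) ∧-lowerʳ m)
  -- `r` is applied at `1[ h⁺ φ ]`, whose image under `fᵏ` is `h⁺ (A φ)`.
  ∈⇒clause (A φ)    u m = lift λ v r → ∈⇒language φ v (r _ m)
  ∈⇒clause (K φ)    u m = λ v r → ∈⇒truth φ v (r _ m)

proposition6 : ∀ {a c ℓ}
  (em : ExcludedMiddle (suc (c ⊔ ℓ)))
  (zorn : Zorn (suc (c ⊔ ℓ)) (c ⊔ ℓ) (c ⊔ ℓ) (suc (c ⊔ ℓ)))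
  {ℙ : Set a} (RBf : MRBAᵏ c ℓ)
  (h : Homomorphism (𝓛-algebra ℙ) (MRBAᵏ.raw RBf)) →
  let open MRBAᵏ RBf using (1[_])
      open Extension RBf h using (h⁺)
      open Canonical RBf h using (canonicalModel)
      M = canonicalModel em zorn
  in
  (φ : 𝓛ᴬᴷ ℙ) →
  (L⟦_⟧ M φ ≐ λ u → 1[ h⁺ φ ] ∈ proj₁ u) × (V⟦_⟧ M φ ≐ λ u → h⁺ φ ∈ proj₁ u)
proposition6 em zorn RBf h φ =
  ((λ {u} → language⇒∈ φ u) , (λ {u} → ∈⇒language φ u)) ,
  ((λ {u} → truth⇒∈ φ u) , (λ {u} → ∈⇒truth φ u))
  where open TruthLemma RBf h em zorn
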